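{- Let $f:2^{[n]}\to\mathbb{R}_{\ge 0}$ be a non-negative, monotone set function and let $F:[0,1]^n\to\mathbb{R}$ be its multilinear extension. Let $x\in[0,1]^n\setminus\{\vec 0\}$ and $\gamma\ge 0$. Suppose that for all $i,j\in[n]$, $$\mathbb{E}_{R\sim x}[|R|]\cdot\mathbb{E}_{R\sim x}[A_{ij}(R)]\le\gamma\cdot\big(\mathbb{E}_{R\sim x}[B_i(R)]+\mathbb{E}_{R\sim x}[B_j(R)]\big),$$ where $R\sim x$ denotes a random subset of $[n]$ containing each element $i$ independently with probability $x_i$ (equivalently, $\|x\|_1\nabla^2_{ij}F(x)\le\gamma(\nabla_iF(x)+\nabla_jF(x))$). Then $F$ is one-sided $\gamma$-smooth at $x$.
   Context: $[n]=\{1,\dots,n\}$; $S+i=S\cup\{i\}$, $S-i=S\setminus\{i\}$ (operations applied from left to right). For a set function $f$ on $2^{[n]}$, define $B_i(S)=f(S+i)-f(S-i)$ and $A_{ij}(S)=B_j(S+i)-B_j(S-i)=f(S+i+j)-f(S+i-j)-f(S-i+j)+f(S-i-j)$ (so $A_{ii}(S)=0$). $f$ is monotone if all $B_i(S)\ge 0$. The multilinear extension is $F(x)=\sum_{R\subseteq[n]} f(R)\prod_{v\in R}x_v\prod_{v\in[n]\setminus R}(1-x_v)$. A twice continuously differentiable $F:[0,1]^n\to\mathbb{R}$ is one-sided $\sigma$-smooth at $x\ne\vec 0$ if for every $u\in[0,1]^n$, $\frac12 u^\top\nabla^2F(x)u\le\sigma\,\frac{\|u\|_1}{\|x\|_1}\,u^\top\nabla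 F(x)$. -}

module Defs where

open import Algebra.Apartness.Bundles using (HeytingField)
open import Algebra.Bundles using (CommutativeRing)
import Algebra.Definitions.RawMonoid as RawMonoid
open import Data.Bool.Base using (if_then_else_)
open import Data.Fin.Base using (Fin; zero; suc)
open import Data.Fin.Subset using (Subset; inside; outside; ⁅_⁆; _∪_; ∁)
  renaming (∣_∣ to card; _-_ to _∖_)
open import Data.Nat.Base as ℕ using (ℕ; zero; suc)
open import Data.Product.Base using (Σ-syntax; ∃-syntax; _×_; _,_; proj₁; proj₂)
open import Data.Sum.Base using (_⊎_; inj₁; inj₂)
open import Data.Vec.Base using ([]; _∷_; lookup)
open import Data.Vec.Functional using (Vector)
open import Function.Bundles using (_⇔_; Equivalence)
import Level as L
open import Relation.Binary.Core using (Rel)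
open import Relation.Binary.Lattice.Definitions using (Supremum)
open import Relation.Binary.PropositionalEquality.Core using (_≢_)
open import Relation.Binary.Structures using (IsStrictPartialOrder)
open import Relation.Nullary.Negation using (¬_; contradiction)

-- The real numbers, axiomatised as a Cauchy-complete Archimedean ordered
-- Heyting field with binary maxima.  With excluded middle this
-- characterises ℝ up to isomorphism.  "x # y" is the positive form of "x ≠ y".

record Reals c ℓ₁ ℓ₂ ℓ₃ : Set (L.suc (c L.⊔ ℓ₁ L.⊔ ℓ₂ L.⊔ ℓ₃)) where
  infix 4 _<_ _≤_
  infixl 6 _⊔_
  field
    heytingField : HeytingField c ℓ₁ ℓ₂

  open HeytingField heytingField public renaming (Carrier to ℝ; zero to *-zero)

  commutativeRing : CommutativeRing c ℓ₁
  commutativeRing = record { isCommutativeRing = isCommutativeRing }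

  open CommutativeRing commutativeRing public
    using (+-rawMonoid; *-rawMonoid)

  field
    _<_                  : Rel ℝ ℓ₃
    <-isStrictPartialOrder : IsStrictPartialOrder _≈_ _<_
    #⇔<⊎>                : ∀ {x y} → (x # y) ⇔ (x < y ⊎ y < x)
    0<1                  : 0# < 1#
    +-monoˡ-<            : ∀ z {x y} → x < y → x + z < y + z
    *-pos                : ∀ {x y} → 0# < x → 0# < y → 0# < x * y

  _≤_ : Rel ℝ ℓ₃
  x ≤ y = ¬ (y < x)

  fromℕ : ℕ → ℝ
  fromℕ k = RawMonoid._×_ +-rawMonoid k 1#

  field
    _⊔_      : ℝ → ℝ → ℝ
    ⊔-sup    : Supremum _≤_ _⊔_
    archimedean : ∀ x → ∃[ k ] x < fromℕ k

  ∣_∣ : ℝ → ℝ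
  ∣ x ∣ = x ⊔ (- x)

  field
    complete : (s : ℕ → ℝ) →
      (∀ ε → 0# < ε →
        ∃[ N ] ∀ k m → N ℕ.≤ k → N ℕ.≤ m → ∣ s k - s m ∣ < ε) →
      ∃[ l ] ∀ ε → 0# < ε → ∃[ N ] ∀ k → N ℕ.≤ k → ∣ s k - l ∣ < ε


module Smoothness {c ℓ₁ ℓ₂ ℓ₃} (𝓡 : Reals c ℓ₁ ℓ₂ ℓ₃) where

  open Reals 𝓡
  open RawMonoid +-rawMonoid public using (sum)
  open RawMonoid *-rawMonoid public using () renaming (sum to product)
  private
    module R  = CommutativeRing commutativeRing
    module SP = IsStrictPartialOrder <-isStrictPartialOrder

  -- The library gives an inverse of b - 0#, which equals b.
  _/_[_] : ∀ (a b : ℝ) → b # 0# → ℝ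
  a / b [ b#0 ] = a * proj₁ (#⇒invertible b#0)

  <-cotrans : ∀ {x y} → x < y → ∀ z → x < z ⊎ z < y
  <-cotrans x<y z with #-cotrans (Equivalence.from #⇔<⊎> (inj₁ x<y)) z
  ... | inj₁ x#z with Equivalence.to #⇔<⊎> x#z
  ...   | inj₁ x<z = inj₁ x<z
  ...   | inj₂ z<x = inj₂ (SP.trans z<x x<y)
  <-cotrans x<y z | inj₂ z#y with Equivalence.to #⇔<⊎> z#y
  ...   | inj₁ z<y = inj₂ z<y
  ...   | inj₂ y<z = inj₁ (SP.trans x<y y<z)

  pos⇒#0 : ∀ {x} → 0# < x → x # 0#
  pos⇒#0 0<x = Equivalence.from #⇔<⊎> (inj₂ 0<x)

  a+b<b⇒a<0 : ∀ {a b} → a + b < b → a < 0#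
  a+b<b⇒a<0 {a} {b} p =
    SP.<-respʳ-≈ (R.-‿inverseʳ b)
      (SP.<-respˡ-≈
        (R.trans (R.+-assoc a b (- b))
          (R.trans (R.+-congˡ (R.-‿inverseʳ b)) (R.+-identityʳ a)))
        (+-monoˡ-< (- b) p))

  +-nonNeg-pos : ∀ {a b} → 0# ≤ a → 0# < b → 0# < a + b
  +-nonNeg-pos {a} {b} 0≤a 0<b with <-cotrans 0<b (a + b)
  ... | inj₁ 0<a+b = 0<a+b
  ... | inj₂ a+b<b = contradiction (a+b<b⇒a<0 a+b<b) 0≤a

  +-nonNeg : ∀ {a b} → 0# ≤ a → 0# ≤ b → 0# ≤ a + b
  +-nonNeg {a} {b} 0≤a 0≤b a+b<0 with <-cotrans a+b<0 b
  ... | inj₁ a+b<b = 0≤a (a+b<b⇒a<0 a+b<b)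
  ... | inj₂ b<0   = 0≤b b<0

  sum-nonNeg : ∀ {n} (v : Vector ℝ n) → (∀ i → 0# ≤ v i) → 0# ≤ sum v
  sum-nonNeg {zero}  v p = SP.irrefl R.refl
  sum-nonNeg {suc n} v p =
    +-nonNeg (p zero) (sum-nonNeg (λ i → v (suc i)) (λ i → p (suc i)))

  sum-pos : ∀ {n} (v : Vector ℝ n) → (∀ i → 0# ≤ v i) →
            ∀ i → 0# < v i → 0# < sum v
  sum-pos {suc n} v p zero    0<v =
    SP.<-respʳ-≈ (R.+-comm _ _)
      (+-nonNeg-pos (sum-nonNeg (λ i → v (suc i)) (λ i → p (suc i))) 0<v)
  sum-pos {suc n} v p (suc i) 0<v =
    +-nonNeg-pos (p zero) (sum-pos (λ i → v (suc i)) (λ i → p (suc i)) i 0<v)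

  neg⇒-pos : ∀ {x} → x < 0# → 0# < - x
  neg⇒-pos {x} x<0 =
    SP.<-respʳ-≈ (R.+-identityˡ (- x))
      (SP.<-respˡ-≈ (R.-‿inverseʳ x) (+-monoˡ-< (- x) x<0))

  pos-≤-pos : ∀ {x y} → 0# < x → x ≤ y → 0# < y
  pos-≤-pos {x} {y} 0<x x≤y with <-cotrans 0<x y
  ... | inj₁ 0<y = 0<y
  ... | inj₂ y<x = contradiction y<x x≤y

  abs-pos : ∀ {x} → x # 0# → 0# < ∣ x ∣
  abs-pos {x} x#0 with Equivalence.to #⇔<⊎> x#0
  ... | inj₁ x<0 = pos-≤-pos (neg⇒-pos x<0) (proj₁ (proj₂ (⊔-sup x (- x))))
  ... | inj₂ 0<x = pos-≤-pos 0<x (proj₁ (⊔-sup x (- x)))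

  abs-nonNeg : ∀ x → 0# ≤ ∣ x ∣
  abs-nonNeg x ∣x∣<0 with <-cotrans ∣x∣<0 x
  ... | inj₁ ∣x∣<x = proj₁ (⊔-sup x (- x)) ∣x∣<x
  ... | inj₂ x<0   =
    SP.irrefl R.refl (SP.trans (abs-pos (Equivalence.from #⇔<⊎> (inj₁ x<0))) ∣x∣<0)

  ½ : ℝ
  ½ = 1# / (1# + 1#) [ pos⇒#0 (+-nonNeg-pos (SP.asym 0<1) 0<1) ]

  record Cube (n : ℕ) : Set (c L.⊔ ℓ₃) where
    field
      coord : Vector ℝ n
      0≤    : ∀ i → 0# ≤ coord i
      ≤1    : ∀ i → coord i ≤ 1#
  open Cube public

  Nonzero : ∀ {n} → Vector ℝ n → Set ℓ₂
  Nonzero v = ∃[ i ] v i # 0#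

  ‖_‖₁ : ∀ {n} → Vector ℝ n → ℝ
  ‖ v ‖₁ = sum (λ i → ∣ v i ∣)

  ‖‖₁#0 : ∀ {n} {v : Vector ℝ n} → Nonzero v → ‖ v ‖₁ # 0#
  ‖‖₁#0 {v = v} (i , vᵢ#0) =
    pos⇒#0 (sum-pos (λ i → ∣ v i ∣) (λ i → abs-nonNeg (v i)) i (abs-pos vᵢ#0))

  ContinuousAt : ∀ {n} → (Cube n → ℝ) → Cube n → Set (c L.⊔ ℓ₃)
  ContinuousAt F x =
    ∀ ε → 0# < ε → Σ[ δ ∈ ℝ ] 0# < δ ×
      (∀ y → (∀ k → ∣ coord y k - coord x k ∣ < δ) → ∣ F y - F x ∣ < ε)

  -- d is the i-th partial derivative of F at x, relative to the cube (hence
  -- one-sided when xᵢ is 0 or 1).  It is unique, because the fibre of the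
  -- cube through x in direction i is an interval of length one.
  HasPartialAt : ∀ {n} → (Cube n → ℝ) → Fin n → Cube n → ℝ → Set (c L.⊔ ℓ₁ L.⊔ ℓ₃)
  HasPartialAt F i x d =
    ∀ ε → 0# < ε → Σ[ δ ∈ ℝ ] 0# < δ ×
      (∀ y → (∀ k → k ≢ i → coord y k ≈ coord x k) →
        ∣ coord y i - coord x i ∣ < δ →
        ∣ F y - F x - d * (coord y i - coord x i) ∣ ≤ ε * ∣ coord y i - coord x i ∣)

  record C² {n} (F : Cube n → ℝ) : Set (c L.⊔ ℓ₁ L.⊔ ℓ₃) where
    field
      ∇          : Fin n → Cube n → ℝ
      ∇²         : Fin n → Fin n → Cube n → ℝ
      ∇-partial  : ∀ i x → HasPartialAt F i x (∇ i x)
      ∇²-partial : ∀ i j x → HasPartialAt (∇ i) j x (∇² i j x)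
      F-cont     : ∀ x → ContinuousAt F x
      ∇-cont     : ∀ i x → ContinuousAt (∇ i) x
      ∇²-cont    : ∀ i j x → ContinuousAt (∇² i j) x

  OneSidedSmoothAt : ∀ {n} → ℝ → (Cube n → ℝ) → (x : Cube n) →
                     Nonzero (coord x) → Set (c L.⊔ ℓ₁ L.⊔ ℓ₃)
  OneSidedSmoothAt {n} σ F x x≠0 =
    Σ[ F-C² ∈ C² F ] let open C² F-C² in
      ∀ (u : Cube n) →
        ½ * sum (λ i → sum (λ j → coord u i * ∇² i j x * coord u j))
          ≤ σ * (‖ coord u ‖₁ / ‖ coord x ‖₁ [ ‖‖₁#0 x≠0 ])
              * sum (λ i → coord u i * ∇ i x)

  SetFunction : ℕ → Set c
  SetFunction n = Subset n → ℝ

  B : ∀ {n} → SetFunction n → Fin n → SetFunction n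
  B f i S = f (S ∪ ⁅ i ⁆) - f (S ∖ i)

  A : ∀ {n} → SetFunction n → Fin n → Fin n → SetFunction n
  A f i j S = B f j (S ∪ ⁅ i ⁆) - B f j (S ∖ i)

  NonNegative : ∀ {n} → SetFunction n → Set ℓ₃
  NonNegative f = ∀ S → 0# ≤ f S

  Monotone : ∀ {n} → SetFunction n → Set ℓ₃
  Monotone f = ∀ i S → 0# ≤ B f i S

  sum⊆ : ∀ {n} → SetFunction n → ℝ
  sum⊆ {zero}  g = g []
  sum⊆ {suc n} g = sum⊆ (λ S → g (inside ∷ S)) + sum⊆ (λ S → g (outside ∷ S))

  product∈ : ∀ {n} → Subset n → Vector ℝ n → ℝ
  product∈ S v = product (λ i → if lookup S i then v i else 1#)

  -- Pr[ R ∼ x ]: the product of n independent Bernoulli(xᵢ) laws.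
  Pr : ∀ {n} → Cube n → Subset n → ℝ
  Pr x R = product (λ i → if lookup R i then coord x i else (1# - coord x i))

  𝔼 : ∀ {n} → Cube n → SetFunction n → ℝ
  𝔼 x g = sum⊆ (λ R → Pr x R * g R)

  size : ∀ {n} → SetFunction n
  size R = fromℕ (card R)

  multilinear : ∀ {n} → SetFunction n → Cube n → ℝ
  multilinear f x = sum⊆ (λ R →
    f R * product∈ R (coord x) * product∈ (∁ R) (λ i → 1# - coord x i))

{-# OPTIONS --safe #-}

-- The multilinear extension is F(x) = 𝔼ₓ f, and x ↦ 𝔼ₓ g is affine in every
-- coordinate i with slope 𝔼ₓ (B g i).  Hence ∇ᵢF(x) = 𝔼ₓ (B f i) and
-- ∇²ᵢⱼF(x) = 𝔼ₓ (A f i j), so the hypothesis bounds the Hessian entrywise by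
-- (γ / ‖x‖₁)(∇ᵢF + ∇ⱼF).  Weighting with uᵢuⱼ ≥ 0 and summing gives
-- uᵀ∇²F u ≤ (γ / ‖x‖₁) · 2 ‖u‖₁ (uᵀ∇F).  Continuity holds because the bounded
-- Lipschitz functions on the cube are closed under sums and products.

module Submission where

open import Defs
open import Algebra.Bundles using (CommutativeRing)
import Algebra.Apartness.Properties.HeytingCommutativeRing as HeytingProperties
import Algebra.Properties.CommutativeSemigroup as CommutativeSemigroupProperties
import Algebra.Properties.Ring as RingProperties
import Algebra.Properties.Semiring.Sum as SumProperties
open import Data.Bool.Base using (true; false; if_then_else_)
open import Data.Fin.Base using (Fin; zero; suc)
open import Data.Fin.Properties using (suc-injective)
open import Data.Fin.Subset using (Subset; inside; outside; ⁅_⁆; _∪_; ∁)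
  renaming (_-_ to _∖_)
open import Data.Fin.Subset.Properties using (∪-identityʳ; p─⊥≡p)
open import Data.Nat.Base using (ℕ; zero; suc)
open import Data.Product.Base using (_,_; proj₁; proj₂)
open import Data.Sum.Base using (inj₁; inj₂; [_,_]′)
open import Data.Vec.Base using ([]; _∷_; lookup)
open import Function.Base using (_∘_; _$_)
open import Function.Bundles using (Equivalence)
import Level as L
open import Relation.Binary.Bundles using (Poset)
import Relation.Binary.PropositionalEquality.Core as ≡
open ≡ using (_≢_)
import Relation.Binary.Reasoning.PartialOrder as PosetReasoning
import Relation.Binary.Reasoning.Setoid as SetoidReasoning
open import Relation.Binary.Structures using (IsStrictPartialOrder)
open import Relation.Nullary.Negation using (¬_; contradiction)

-- Arithmetic, order and absolute value in a constructive ordered field.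

module OrderedField {c ℓ₁ ℓ₂ ℓ₃} (𝓡 : Reals c ℓ₁ ℓ₂ ℓ₃) where

  open Reals 𝓡
  open Smoothness 𝓡

  module R  = CommutativeRing commutativeRing
  module SP = IsStrictPartialOrder <-isStrictPartialOrder
  open RingProperties R.ring public
  open HeytingProperties (Reals.heytingCommutativeRing 𝓡) public
    using (x-0≈x; invertibleˡ⇒#)
  module ⟨+⟩ = CommutativeSemigroupProperties R.+-commutativeSemigroup
  module ⟨*⟩ = CommutativeSemigroupProperties R.*-commutativeSemigroup
  module ≈-Reasoning = SetoidReasoning R.setoid

  x+y-[z+w]≈[x-z]+[y-w] : ∀ x y z w → (x + y) - (z + w) ≈ (x - z) + (y - w)
  x+y-[z+w]≈[x-z]+[y-w] x y z w =
    trans (+-congˡ (sym (-‿+-comm z w))) (⟨+⟩.interchange x y (- z) (- w))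

  [x-y]+[y-z]≈x-z : ∀ x y z → (x - y) + (y - z) ≈ x - z
  [x-y]+[y-z]≈x-z x y z =
    trans (sym (+-assoc (x - y) y (- z))) (+-congʳ (//-rightDividesˡ y x))

  xy-zw≈x[y-w]+[x-z]w : ∀ x y z w → x * y - z * w ≈ x * (y - w) + (x - z) * w
  xy-zw≈x[y-w]+[x-z]w x y z w = sym $
    trans (+-cong (x[y-z]≈xy-xz x y w) ([y-z]x≈yx-zx w x z))
          ([x-y]+[y-z]≈x-z (x * y) (x * w) (z * w))

  mix-sub : ∀ p q a b a′ b′ →
    p * (a - a′) + q * (b - b′) ≈ (p * a + q * b) - (p * a′ + q * b′)
  mix-sub p q a b a′ b′ =
    trans (+-cong (x[y-z]≈xy-xz p a a′) (x[y-z]≈xy-xz q b b′))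
          (sym (x+y-[z+w]≈[x-z]+[y-w] (p * a) (q * b) (p * a′) (q * b′)))

  -- Exhibits a Bernoulli average as an affine function of its weight `x`, with slope `a - b`. The
  -- slope of an expectation in one coordinate comes from here.
  mix : ∀ x a b → x * a + (1# - x) * b ≈ b + x * (a - b)
  mix x a b = begin
    x * a + (1# - x) * b      ≈⟨ +-congˡ ([y-z]x≈yx-zx b 1# x) ⟩
    x * a + (1# * b - x * b)  ≈⟨ +-congˡ (+-congʳ (*-identityˡ b)) ⟩
    x * a + (b - x * b)       ≈⟨ ⟨+⟩.x∙yz≈y∙xz (x * a) b (- (x * b)) ⟩
    b + (x * a - x * b)       ≈⟨ +-congˡ (x[y-z]≈xy-xz x a b) ⟨
    b + x * (a - b)           ∎
    where open ≈-Reasoning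

  mix-idem : ∀ x a → x * a + (1# - x) * a ≈ a
  mix-idem x a = begin
    x * a + (1# - x) * a  ≈⟨ mix x a a ⟩
    a + x * (a - a)       ≈⟨ +-congˡ (*-congˡ (-‿inverseʳ a)) ⟩
    a + x * 0#            ≈⟨ +-congˡ (zeroʳ x) ⟩
    a + 0#                ≈⟨ +-identityʳ a ⟩
    a                     ∎
    where open ≈-Reasoning

  -- A refutation: if `z < x`, cotransitivity puts `y` above `z` or below `x`, and each contradicts
  -- one hypothesis.
  ≤-trans : ∀ {x y z} → x ≤ y → y ≤ z → x ≤ z
  ≤-trans {y = y} x≤y y≤z z<x = [ y≤z , x≤y ]′ (<-cotrans z<x y)

  ≤-reflexive : ∀ {x y} → x ≈ y → x ≤ y
  ≤-reflexive x≈y = SP.irrefl (sym x≈y)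

  -- Apartness is tight: `x # y` would give a strict inequality one way or the other, and both are
  -- excluded.
  ≤-antisym : ∀ {x y} → x ≤ y → y ≤ x → x ≈ y
  ≤-antisym x≤y y≤x =
    proj₁ (tight _ _) (λ x#y → [ y≤x , x≤y ]′ (Equivalence.to #⇔<⊎> x#y))

  ≤-poset : Poset c ℓ₁ ℓ₃
  ≤-poset = record
    { _≤_ = _≤_
    ; isPartialOrder = record
      { isPreorder = record
        { isEquivalence = isEquivalence
        ; reflexive     = ≤-reflexive
        ; trans         = ≤-trans
        }
      ; antisym = ≤-antisym
      }
    }

  module ≤-Reasoning = PosetReasoning ≤-poset

  <⇒≤ : ∀ {x y} → x < y → x ≤ y
  <⇒≤ = SP.asym

  ≤-<-trans : ∀ {x y z} → x ≤ y → y < z → x < z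
  ≤-<-trans {x} x≤y y<z with <-cotrans y<z x
  ... | inj₁ y<x = contradiction y<x x≤y
  ... | inj₂ x<z = x<z

  +-monoˡ-≤ : ∀ z {x y} → x ≤ y → x + z ≤ y + z
  +-monoˡ-≤ z {x} {y} x≤y y+z<x+z = x≤y $
    SP.<-respˡ-≈ (//-rightDividesʳ z y) $
    SP.<-respʳ-≈ (//-rightDividesʳ z x) (+-monoˡ-< (- z) y+z<x+z)

  +-monoʳ-≤ : ∀ z {x y} → x ≤ y → z + x ≤ z + y
  +-monoʳ-≤ z {x} {y} x≤y = begin
    z + x  ≈⟨ +-comm z x ⟩
    x + z  ≤⟨ +-monoˡ-≤ z x≤y ⟩
    y + z  ≈⟨ +-comm y z ⟩
    z + y  ∎
    where open ≤-Reasoning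

  +-mono-≤ : ∀ {x y z w} → x ≤ y → z ≤ w → x + z ≤ y + w
  +-mono-≤ x≤y z≤w = ≤-trans (+-monoˡ-≤ _ x≤y) (+-monoʳ-≤ _ z≤w)

  x≤y⇒0≤y-x : ∀ {x y} → x ≤ y → 0# ≤ y - x
  x≤y⇒0≤y-x {x} x≤y =
    ≤-trans (≤-reflexive (sym (-‿inverseʳ x))) (+-monoˡ-≤ (- x) x≤y)

  0≤y-x⇒x≤y : ∀ {x y} → 0# ≤ y - x → x ≤ y
  0≤y-x⇒x≤y {x} {y} 0≤y-x = begin
    x          ≈⟨ +-identityˡ x ⟨
    0# + x     ≤⟨ +-monoˡ-≤ x 0≤y-x ⟩
    y - x + x  ≈⟨ //-rightDividesˡ x y ⟩
    y          ∎
    where open ≤-Reasoning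

  -- Since `_≤_` is a negation, the goal is a contradiction, so one may split on the sign of `x`
  -- although order is not decidable. If `x ≤ 0#` then `x` vanishes. If `0# < x` then `y` cannot be
  -- positive and vanishes. Either way the product is zero, against `xy<0`.
  *-nonNeg : ∀ {x y} → 0# ≤ x → 0# ≤ y → 0# ≤ x * y
  *-nonNeg {x} {y} 0≤x 0≤y xy<0 = ¬x≤0 ¬0<x
    where
    xy≉0 : ¬ (x * y ≈ 0#)
    xy≉0 xy≈0 = SP.irrefl xy≈0 xy<0
    ¬0<x : ¬ (0# < x)
    ¬0<x 0<x = xy≉0 (trans (*-congˡ (≤-antisym ¬0<y 0≤y)) (zeroʳ x))
      where
      ¬0<y : ¬ (0# < y)
      ¬0<y 0<y = SP.asym (*-pos 0<x 0<y) xy<0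
    ¬x≤0 : ¬ (x ≤ 0#)
    ¬x≤0 x≤0 = xy≉0 (trans (*-congʳ (≤-antisym x≤0 0≤x)) (zeroˡ y))

  *-monoˡ-≤-nonNeg : ∀ {x y z} → 0# ≤ z → x ≤ y → z * x ≤ z * y
  *-monoˡ-≤-nonNeg {x} {y} {z} 0≤z x≤y = 0≤y-x⇒x≤y $
    ≤-trans (*-nonNeg 0≤z (x≤y⇒0≤y-x x≤y)) (≤-reflexive (x[y-z]≈xy-xz z y x))

  *-monoʳ-≤-nonNeg : ∀ {x y z} → 0# ≤ z → x ≤ y → x * z ≤ y * z
  *-monoʳ-≤-nonNeg {x} {y} {z} 0≤z x≤y = begin
    x * z  ≈⟨ *-comm x z ⟩
    z * x  ≤⟨ *-monoˡ-≤-nonNeg 0≤z x≤y ⟩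
    z * y  ≈⟨ *-comm z y ⟩
    y * z  ∎
    where open ≤-Reasoning

  *-mono-≤-nonNeg : ∀ {x y z w} → 0# ≤ y → 0# ≤ z → x ≤ y → z ≤ w → x * z ≤ y * w
  *-mono-≤-nonNeg 0≤y 0≤z x≤y z≤w =
    ≤-trans (*-monoʳ-≤-nonNeg 0≤z x≤y) (*-monoˡ-≤-nonNeg 0≤y z≤w)

  ≤0⇒-nonNeg : ∀ {x} → x ≤ 0# → 0# ≤ - x
  ≤0⇒-nonNeg {x} x≤0 = ≤-trans (x≤y⇒0≤y-x x≤0) (≤-reflexive (+-identityˡ (- x)))

  -- An invertible element is apart from zero, hence negative or positive. If `x` were negative,
  -- `- x * y`, which is `- 1#`, would be positive, and so would `1# - 1#`.
  inverse-pos : ∀ {x y} → 0# < y → x * y ≈ 1# → 0# < x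
  inverse-pos {x} {y} 0<y xy≈1
    with Equivalence.to #⇔<⊎>
      (invertibleˡ⇒# (y , trans (*-congˡ (x-0≈x x)) (trans (*-comm y x) xy≈1)))
  ... | inj₂ 0<x = 0<x
  ... | inj₁ x<0 = contradiction (+-nonNeg-pos (<⇒≤ 0<1) 0<-1) (≤-reflexive (-‿inverseʳ 1#))
    where
    0<-1 : 0# < - 1#
    0<-1 = SP.<-respʳ-≈ (trans (sym (-‿distribˡ-* x y)) (-‿cong xy≈1)) $
      *-pos (neg⇒-pos x<0) 0<y

  -- This is the factor by which `_/_[_]` multiplies, so `a / b [ b#0 ]` unfolds to
  -- `a * reciprocal b#0`.
  reciprocal : ∀ {x} → x # 0# → ℝ
  reciprocal x#0 = proj₁ (#⇒invertible x#0)

  reciprocal-inverseˡ : ∀ {x} (x#0 : x # 0#) → reciprocal x#0 * x ≈ 1#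
  reciprocal-inverseˡ {x} x#0 =
    trans (*-congˡ (sym (x-0≈x x))) (proj₁ (proj₂ (#⇒invertible x#0)))

  reciprocal-pos : ∀ {x} → 0# < x → (x#0 : x # 0#) → 0# < reciprocal x#0
  reciprocal-pos 0<x x#0 = inverse-pos 0<x (reciprocal-inverseˡ x#0)

  0≤½ : 0# ≤ ½
  0≤½ = *-nonNeg (<⇒≤ 0<1) (<⇒≤ (reciprocal-pos (+-nonNeg-pos (<⇒≤ 0<1) 0<1) _))

  ½*[x+x]≈x : ∀ x → ½ * (x + x) ≈ x
  ½*[x+x]≈x x = begin
    ½ * (x + x)            ≈⟨ *-congˡ (+-cong (*-identityˡ x) (*-identityˡ x)) ⟨
    ½ * (1# * x + 1# * x)  ≈⟨ *-congˡ (distribʳ x 1# 1#) ⟨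
    ½ * ((1# + 1#) * x)    ≈⟨ *-assoc ½ (1# + 1#) x ⟨
    -- `½` unfolds to `1#` times the reciprocal of `1# + 1#`; the underscore in the next line is
    -- that reciprocal.
    ½ * (1# + 1#) * x      ≈⟨ *-congʳ (*-congʳ (*-identityˡ _)) ⟩
    _ * (1# + 1#) * x      ≈⟨ *-congʳ (reciprocal-inverseˡ _) ⟩
    1# * x                 ≈⟨ *-identityˡ x ⟩
    x                      ∎
    where open ≈-Reasoning

  x≤∣x∣ : ∀ x → x ≤ ∣ x ∣
  x≤∣x∣ x = proj₁ (⊔-sup x (- x))

  -x≤∣x∣ : ∀ x → - x ≤ ∣ x ∣
  -x≤∣x∣ x = proj₁ (proj₂ (⊔-sup x (- x)))

  ∣∣-least : ∀ {x y} → x ≤ y → - x ≤ y → ∣ x ∣ ≤ y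
  ∣∣-least {x} {y} = proj₂ (proj₂ (⊔-sup x (- x))) y

  -- Congruence of the maximum follows from its being a least upper bound, by antisymmetry.
  ∣∣-cong : ∀ {x y} → x ≈ y → ∣ x ∣ ≈ ∣ y ∣
  ∣∣-cong x≈y = ≤-antisym (∣∣-mono x≈y) (∣∣-mono (sym x≈y))
    where
    ∣∣-mono : ∀ {x y} → x ≈ y → ∣ x ∣ ≤ ∣ y ∣
    ∣∣-mono {x} {y} x≈y = ∣∣-least
      (≤-trans (≤-reflexive x≈y) (x≤∣x∣ y))
      (≤-trans (≤-reflexive (-‿cong x≈y)) (-x≤∣x∣ y))

  nonNeg⇒∣x∣≈x : ∀ {x} → 0# ≤ x → ∣ x ∣ ≈ x
  nonNeg⇒∣x∣≈x {x} 0≤x = ≤-antisym (∣∣-least (≤-reflexive refl) -x≤x) (x≤∣x∣ x)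
    where
    -x≤x : - x ≤ x
    -x≤x = 0≤y-x⇒x≤y $
      ≤-trans (+-nonNeg 0≤x 0≤x) (≤-reflexive (+-congˡ (sym (-‿involutive x))))

  ∣x-x∣≈0 : ∀ x → ∣ x - x ∣ ≈ 0#
  ∣x-x∣≈0 x =
    trans (∣∣-cong (-‿inverseʳ x)) (nonNeg⇒∣x∣≈x (≤-reflexive refl))

  ∣x+y∣≤∣x∣+∣y∣ : ∀ x y → ∣ x + y ∣ ≤ ∣ x ∣ + ∣ y ∣
  ∣x+y∣≤∣x∣+∣y∣ x y = ∣∣-least
    (+-mono-≤ (x≤∣x∣ x) (x≤∣x∣ y))
    (≤-trans (≤-reflexive (sym (-‿+-comm x y))) (+-mono-≤ (-x≤∣x∣ x) (-x≤∣x∣ y)))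

  ∣-x∣≈∣x∣ : ∀ x → ∣ - x ∣ ≈ ∣ x ∣
  ∣-x∣≈∣x∣ x = ≤-antisym (∣-∣≤ x)
    (≤-trans (≤-reflexive (∣∣-cong (sym (-‿involutive x)))) (∣-∣≤ (- x)))
    where
    ∣-∣≤ : ∀ x → ∣ - x ∣ ≤ ∣ x ∣
    ∣-∣≤ x = ∣∣-least (-x≤∣x∣ x)
      (≤-trans (≤-reflexive (-‿involutive x)) (x≤∣x∣ x))

  -- The goal is again a negation, so the signs of `x` may be treated separately. For `x ≤ 0#`,
  -- replacing both factors by their negatives keeps the product and the absolute values and reduces
  -- to the non-negative case.
  xy≤∣x∣∣y∣ : ∀ x y → x * y ≤ ∣ x ∣ * ∣ y ∣
  xy≤∣x∣∣y∣ x y ∣x∣∣y∣<xy = ¬x≤0 λ 0<x → ¬0≤x (<⇒≤ 0<x)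
    where
    open ≤-Reasoning
    nonNeg-case : ∀ {x} y → 0# ≤ x → x * y ≤ ∣ x ∣ * ∣ y ∣
    nonNeg-case {x} y 0≤x = ≤-trans
      (*-monoˡ-≤-nonNeg 0≤x (x≤∣x∣ y))
      (*-monoʳ-≤-nonNeg (abs-nonNeg y) (x≤∣x∣ x))
    ¬0≤x : ¬ (0# ≤ x)
    ¬0≤x 0≤x = nonNeg-case y 0≤x ∣x∣∣y∣<xy
    ¬x≤0 : ¬ (x ≤ 0#)
    ¬x≤0 x≤0 = contradiction ∣x∣∣y∣<xy $ begin
      x * y              ≈⟨ -‿involutive (x * y) ⟨
      - (- (x * y))      ≈⟨ -‿cong (-‿distribˡ-* x y) ⟩
      - (- x * y)        ≈⟨ -‿distribʳ-* (- x) y ⟩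
      - x * - y          ≤⟨ nonNeg-case (- y) (≤0⇒-nonNeg x≤0) ⟩
      ∣ - x ∣ * ∣ - y ∣  ≈⟨ *-cong (∣-x∣≈∣x∣ x) (∣-x∣≈∣x∣ y) ⟩
      ∣ x ∣ * ∣ y ∣      ∎

  ∣xy∣≤∣x∣∣y∣ : ∀ x y → ∣ x * y ∣ ≤ ∣ x ∣ * ∣ y ∣
  ∣xy∣≤∣x∣∣y∣ x y = ∣∣-least (xy≤∣x∣∣y∣ x y) $ begin
    - (x * y)        ≈⟨ -‿distribˡ-* x y ⟩
    - x * y          ≤⟨ xy≤∣x∣∣y∣ (- x) y ⟩
    ∣ - x ∣ * ∣ y ∣  ≈⟨ *-congʳ (∣-x∣≈∣x∣ x) ⟩
    ∣ x ∣ * ∣ y ∣    ∎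
    where open ≤-Reasoning

-- Expectations under product Bernoulli laws.

module Expectation {c ℓ₁ ℓ₂ ℓ₃} (𝓡 : Reals c ℓ₁ ℓ₂ ℓ₃) where

  open Reals 𝓡
  open Smoothness 𝓡
  open OrderedField 𝓡

  tail : ∀ {n} → Cube (suc n) → Cube n
  tail x = record
    { coord = coord x ∘ suc
    ; 0≤    = 0≤ x ∘ suc
    ; ≤1    = ≤1 x ∘ suc
    }

  sum⊆-cong : ∀ {n} {g h : SetFunction n} → (∀ S → g S ≈ h S) → sum⊆ g ≈ sum⊆ h
  sum⊆-cong {zero}  g≈h = g≈h []
  sum⊆-cong {suc n} g≈h =
    +-cong (sum⊆-cong (g≈h ∘ (inside ∷_))) (sum⊆-cong (g≈h ∘ (outside ∷_)))

  *-distribˡ-sum⊆ : ∀ {n} a (g : SetFunction n) → a * sum⊆ g ≈ sum⊆ (λ S → a * g S)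
  *-distribˡ-sum⊆ {zero}  a g = refl
  *-distribˡ-sum⊆ {suc n} a g = trans (distribˡ a _ _)
    (+-cong (*-distribˡ-sum⊆ a (g ∘ (inside ∷_))) (*-distribˡ-sum⊆ a (g ∘ (outside ∷_))))

  -- Conditioning on whether the first element belongs to the random set. The inductions on
  -- expectations below all run through this recursion.
  𝔼-suc : ∀ {n} (x : Cube (suc n)) (g : SetFunction (suc n)) →
    𝔼 x g ≈ coord x zero * 𝔼 (tail x) (g ∘ (inside ∷_))
            + (1# - coord x zero) * 𝔼 (tail x) (g ∘ (outside ∷_))
  𝔼-suc x g = +-cong (pull (coord x zero) inside) (pull (1# - coord x zero) outside)
    where
    pull : ∀ p b → sum⊆ (λ S → p * Pr (tail x) S * g (b ∷ S)) ≈
                   p * 𝔼 (tail x) (g ∘ (b ∷_))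
    pull p b = trans
      (sum⊆-cong (λ S → *-assoc p (Pr (tail x) S) (g (b ∷ S))))
      (sym (*-distribˡ-sum⊆ p (λ S → Pr (tail x) S * g (b ∷ S))))

  𝔼-congʳ : ∀ {n} (x : Cube n) {g h : SetFunction n} →
    (∀ S → g S ≈ h S) → 𝔼 x g ≈ 𝔼 x h
  𝔼-congʳ x g≈h = sum⊆-cong (λ S → *-congˡ (g≈h S))

  𝔼-congˡ : ∀ {n} (x y : Cube n) → (∀ i → coord x i ≈ coord y i) →
    ∀ g → 𝔼 x g ≈ 𝔼 y g
  𝔼-congˡ {zero}  x y x≈y g = refl
  𝔼-congˡ {suc n} x y x≈y g = begin
    𝔼 x g  ≈⟨ 𝔼-suc x g ⟩
    _      ≈⟨ +-cong (*-cong (x≈y zero) (tails inside))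
                     (*-cong (+-congˡ (-‿cong (x≈y zero))) (tails outside)) ⟩
    _      ≈⟨ 𝔼-suc y g ⟨
    𝔼 y g  ∎
    where
    open ≈-Reasoning
    tails : ∀ b → 𝔼 (tail x) (g ∘ (b ∷_)) ≈ 𝔼 (tail y) (g ∘ (b ∷_))
    tails b = 𝔼-congˡ (tail x) (tail y) (x≈y ∘ suc) (g ∘ (b ∷_))

  𝔼-sub : ∀ {n} (x : Cube n) (g h : SetFunction n) →
    𝔼 x (λ S → g S - h S) ≈ 𝔼 x g - 𝔼 x h
  𝔼-sub {zero}  x g h = x[y-z]≈xy-xz 1# (g []) (h [])
  𝔼-sub {suc n} x g h = begin
    𝔼 x (λ S → g S - h S)  ≈⟨ 𝔼-suc x (λ S → g S - h S) ⟩
    _                      ≈⟨ +-cong (*-congˡ (𝔼-sub (tail x) (g ∘ (inside ∷_)) (h ∘ (inside ∷_))))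
                                     (*-congˡ (𝔼-sub (tail x) (g ∘ (outside ∷_)) (h ∘ (outside ∷_)))) ⟩
    _                      ≈⟨ mix-sub (coord x zero) (1# - coord x zero) _ _ _ _ ⟩
    _                      ≈⟨ +-cong (𝔼-suc x g) (-‿cong (𝔼-suc x h)) ⟨
    𝔼 x g - 𝔼 x h          ∎
    where open ≈-Reasoning

  𝔼-const : ∀ {n} (x : Cube n) a → 𝔼 x (λ _ → a) ≈ a
  𝔼-const {zero}  x a = *-identityˡ a
  𝔼-const {suc n} x a = begin
    𝔼 x (λ _ → a)
      ≈⟨ 𝔼-suc x (λ _ → a) ⟩
    _
      ≈⟨ +-cong (*-congˡ (𝔼-const (tail x) a)) (*-congˡ (𝔼-const (tail x) a)) ⟩
    coord x zero * a + (1# - coord x zero) * a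
      ≈⟨ mix-idem (coord x zero) a ⟩
    a  ∎
    where open ≈-Reasoning

  -- Including the first element raises the size by exactly one, so the affine form `mix` has slope
  -- `1#` at each stage. This identifies the factor `𝔼 x size` of the hypothesis with the norm of
  -- `x`.
  𝔼-size : ∀ {n} (x : Cube n) → 𝔼 x size ≈ sum (coord x)
  𝔼-size {zero}  x = zeroʳ 1#
  𝔼-size {suc n} x = begin
    𝔼 x size
      ≈⟨ 𝔼-suc x size ⟩
    p * 𝔼 x′ (λ S → 1# + size S) + (1# - p) * 𝔼 x′ size
      ≈⟨ mix p _ _ ⟩
    𝔼 x′ size + p * (𝔼 x′ (λ S → 1# + size S) - 𝔼 x′ size)
      ≈⟨ +-cong (𝔼-size x′) (*-congˡ (sym (𝔼-sub x′ _ _))) ⟩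
    sum (coord x′) + p * 𝔼 x′ (λ S → 1# + size S - size S)
      ≈⟨ +-congˡ (*-congˡ (𝔼-congʳ x′ (λ S → //-rightDividesʳ (size S) 1#))) ⟩
    sum (coord x′) + p * 𝔼 x′ (λ _ → 1#)
      ≈⟨ +-congˡ (*-congˡ (𝔼-const x′ 1#)) ⟩
    sum (coord x′) + p * 1#
      ≈⟨ +-congˡ (*-identityʳ p) ⟩
    sum (coord x′) + p
      ≈⟨ +-comm _ p ⟩
    p + sum (coord x′)  ∎
    where
    open ≈-Reasoning
    p = coord x zero
    x′ = tail x

  -- Insertion and removal overwrite the head bit and act on the tail by the empty set, so the value
  -- does not depend on `b`.
  B-zero : ∀ {n} (g : SetFunction (suc n)) b (S : Subset n) →
    B g zero (b ∷ S) ≡.≡ g (inside ∷ S) - g (outside ∷ S)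
  B-zero g b S = ≡.cong₂ (λ T U → g T - g U) (insert b) (remove b)
    where
    insert : ∀ b → (b ∷ S) ∪ ⁅ zero ⁆ ≡.≡ inside ∷ S
    insert false = ≡.cong (inside ∷_) (∪-identityʳ S)
    insert true  = ≡.cong (inside ∷_) (∪-identityʳ S)
    remove : ∀ b → (b ∷ S) ∖ zero ≡.≡ outside ∷ S
    remove b = ≡.cong (outside ∷_) (p─⊥≡p S)

  -- The case split is there because the head bit of the union computes only once `b` is known.
  B-suc : ∀ {n} (g : SetFunction (suc n)) i b (S : Subset n) →
    B g (suc i) (b ∷ S) ≡.≡ B (g ∘ (b ∷_)) i S
  B-suc g i false S = ≡.refl
  B-suc g i true  S = ≡.refl

  -- Induction on `i`. At the head, `a` and `b` are the expectations conditioned on membership and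
  -- non-membership of the first element, so the difference is `(q - p) * (a - b)`. Below the head,
  -- both points give the two faces the same weights, and the induction applies on each face. The
  -- identity has no remainder term.
  𝔼-difference : ∀ {n} (g : SetFunction n) i (x y : Cube n) →
    (∀ k → k ≢ i → coord y k ≈ coord x k) →
    𝔼 y g - 𝔼 x g ≈ 𝔼 x (B g i) * (coord y i - coord x i)
  𝔼-difference g zero x y y≈x = begin
    𝔼 y g - 𝔼 x g
      ≈⟨ +-cong (trans (𝔼-suc y g) (+-cong (*-congˡ (y′≈x′ _)) (*-congˡ (y′≈x′ _)))) (-‿cong (𝔼-suc x g)) ⟩
    (q * a + (1# - q) * b) - (p * a + (1# - p) * b)
      ≈⟨ +-cong (mix q a b) (-‿cong (mix p a b)) ⟩
    (b + q * (a - b)) - (b + p * (a - b))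
      ≈⟨ x+y-[z+w]≈[x-z]+[y-w] b _ b _ ⟩
    (b - b) + (q * (a - b) - p * (a - b))
      ≈⟨ +-cong (-‿inverseʳ b) (sym ([y-z]x≈yx-zx (a - b) q p)) ⟩
    0# + (q - p) * (a - b)
      ≈⟨ +-identityˡ _ ⟩
    (q - p) * (a - b)
      ≈⟨ *-comm (q - p) (a - b) ⟩
    (a - b) * (q - p)
      ≈⟨ *-congʳ 𝔼B≈a-b ⟨
    𝔼 x (B g zero) * (q - p)  ∎
    where
    open ≈-Reasoning
    p = coord x zero
    q = coord y zero
    a = 𝔼 (tail x) (g ∘ (inside ∷_))
    b = 𝔼 (tail x) (g ∘ (outside ∷_))
    y′≈x′ : ∀ h → 𝔼 (tail y) h ≈ 𝔼 (tail x) h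
    y′≈x′ = 𝔼-congˡ (tail y) (tail x) (λ k → y≈x (suc k) λ ())
    -- `B g zero` takes the same values on both faces, so averaging them with weights `p` and
    -- `1# - p` has no effect.
    𝔼B≈a-b : 𝔼 x (B g zero) ≈ a - b
    𝔼B≈a-b = begin
      𝔼 x (B g zero)                   ≈⟨ 𝔼-suc x (B g zero) ⟩
      _                                ≈⟨ +-cong (*-congˡ (face inside)) (*-congˡ (face outside)) ⟩
      p * (a - b) + (1# - p) * (a - b) ≈⟨ mix-idem p (a - b) ⟩
      a - b                            ∎
      where
      face : ∀ s → 𝔼 (tail x) (B g zero ∘ (s ∷_)) ≈ a - b
      face s = trans
        (𝔼-congʳ (tail x) (λ S → reflexive (B-zero g s S)))
        (𝔼-sub (tail x) (g ∘ (inside ∷_)) (g ∘ (outside ∷_)))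
  𝔼-difference g (suc i) x y y≈x = begin
    𝔼 y g - 𝔼 x g
      ≈⟨ +-cong (trans (𝔼-suc y g) (+-cong (*-congʳ q≈p) (*-congʳ (+-congˡ (-‿cong q≈p)))))
                (-‿cong (𝔼-suc x g)) ⟩
    _
      ≈⟨ mix-sub p (1# - p) _ _ _ _ ⟨
    _
      ≈⟨ +-cong (*-congˡ (face inside)) (*-congˡ (face outside)) ⟩
    p * (slope inside * t) + (1# - p) * (slope outside * t)
      ≈⟨ +-cong (*-assoc p _ t) (*-assoc (1# - p) _ t) ⟨
    p * slope inside * t + (1# - p) * slope outside * t
      ≈⟨ distribʳ t _ _ ⟨
    (p * slope inside + (1# - p) * slope outside) * t
      ≈⟨ *-congʳ (𝔼-suc x (B g (suc i))) ⟨
    𝔼 x (B g (suc i)) * t  ∎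
    where
    open ≈-Reasoning
    p = coord x zero
    t = coord y (suc i) - coord x (suc i)
    slope : _ → ℝ
    slope s = 𝔼 (tail x) (B g (suc i) ∘ (s ∷_))
    q≈p : coord y zero ≈ p
    q≈p = y≈x zero λ ()
    face : ∀ s → 𝔼 (tail y) (g ∘ (s ∷_)) - 𝔼 (tail x) (g ∘ (s ∷_)) ≈ slope s * t
    face s = trans
      (𝔼-difference (g ∘ (s ∷_)) i (tail x) (tail y)
        (λ k k≢i → y≈x (suc k) (k≢i ∘ suc-injective)))
      (*-congʳ (𝔼-congʳ (tail x) (λ S → reflexive (≡.sym (B-suc g i s S)))))

  -- In every coordinate exactly one of the two products contributes the default factor `1#`, so
  -- interchanging factors merges them into a single Bernoulli product.
  product∈-Pr : ∀ {n} (x : Cube n) (S : Subset n) →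
    product∈ S (coord x) * product∈ (∁ S) (λ i → 1# - coord x i) ≈ Pr x S
  product∈-Pr x []          = *-identityˡ 1#
  product∈-Pr x (true ∷ S)  = trans (⟨*⟩.interchange _ _ _ _)
    (*-cong (*-identityʳ _) (product∈-Pr (tail x) S))
  product∈-Pr x (false ∷ S) = trans (⟨*⟩.interchange _ _ _ _)
    (*-cong (*-identityˡ _) (product∈-Pr (tail x) S))

  multilinear≈𝔼 : ∀ {n} (f : SetFunction n) x → multilinear f x ≈ 𝔼 x f
  multilinear≈𝔼 f x = sum⊆-cong λ S →
    trans (*-assoc (f S) _ _) (trans (*-comm (f S) _) (*-congʳ (product∈-Pr x S)))

-- Lipschitz bounds, continuity and partial derivatives on the cube.

module Regularity {c ℓ₁ ℓ₂ ℓ₃} (𝓡 : Reals c ℓ₁ ℓ₂ ℓ₃) where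

  open Reals 𝓡
  open Smoothness 𝓡
  open OrderedField 𝓡
  open Expectation 𝓡

  -- Boundedness is carried along because the Lipschitz constant of a product involves bounds of the
  -- factors. Distance enters through any common bound `δ` on the coordinate differences, which
  -- expresses the sup norm without forming a maximum over coordinates.
  record BoundedLipschitz {n} (h : Cube n → ℝ) : Set (c L.⊔ ℓ₃) where
    field
      bound slope : ℝ
      0≤bound     : 0# ≤ bound
      0≤slope     : 0# ≤ slope
      bounded     : ∀ x → ∣ h x ∣ ≤ bound
      lipschitz   : ∀ x y δ → 0# ≤ δ → (∀ k → ∣ coord y k - coord x k ∣ ≤ δ) →
                    ∣ h y - h x ∣ ≤ slope * δ

  module _ where
    open BoundedLipschitz
    open ≤-Reasoning

    constant-lipschitz : ∀ {n} a → BoundedLipschitz {n} (λ _ → a)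
    constant-lipschitz a = record
      { bound     = ∣ a ∣
      ; slope     = 0#
      ; 0≤bound   = abs-nonNeg a
      ; 0≤slope   = ≤-reflexive refl
      ; bounded   = λ _ → ≤-reflexive refl
      ; lipschitz = λ _ _ δ _ _ → ≤-reflexive (trans (∣x-x∣≈0 a) (sym (zeroˡ δ)))
      }

    coord-lipschitz : ∀ {n} (i : Fin n) → BoundedLipschitz (λ x → coord x i)
    coord-lipschitz i = record
      { bound     = 1#
      ; slope     = 1#
      ; 0≤bound   = <⇒≤ 0<1
      ; 0≤slope   = <⇒≤ 0<1
      ; bounded   = λ x → ≤-trans (≤-reflexive (nonNeg⇒∣x∣≈x (0≤ x i))) (≤1 x i)
      ; lipschitz = λ _ _ δ _ near → ≤-trans (near i) (≤-reflexive (sym (*-identityˡ δ)))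
      }

    neg-lipschitz : ∀ {n} {h : Cube n → ℝ} →
      BoundedLipschitz h → BoundedLipschitz (λ x → - h x)
    neg-lipschitz {h = h} H = record
      { bound     = bound H
      ; slope     = slope H
      ; 0≤bound   = 0≤bound H
      ; 0≤slope   = 0≤slope H
      ; bounded   = λ x → ≤-trans (≤-reflexive (∣-x∣≈∣x∣ (h x))) (bounded H x)
      ; lipschitz = λ x y δ 0≤δ near → begin
          ∣ - h y - - h x ∣   ≈⟨ ∣∣-cong (-‿+-comm (h y) (- h x)) ⟩
          ∣ - (h y - h x) ∣   ≈⟨ ∣-x∣≈∣x∣ (h y - h x) ⟩
          ∣ h y - h x ∣       ≤⟨ lipschitz H x y δ 0≤δ near ⟩
          slope H * δ         ∎
      }

    +-lipschitz : ∀ {n} {h k : Cube n → ℝ} →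
      BoundedLipschitz h → BoundedLipschitz k → BoundedLipschitz (λ x → h x + k x)
    +-lipschitz {h = h} {k} H K = record
      { bound     = bound H + bound K
      ; slope     = slope H + slope K
      ; 0≤bound   = +-nonNeg (0≤bound H) (0≤bound K)
      ; 0≤slope   = +-nonNeg (0≤slope H) (0≤slope K)
      ; bounded   = λ x → ≤-trans (∣x+y∣≤∣x∣+∣y∣ (h x) (k x)) (+-mono-≤ (bounded H x) (bounded K x))
      ; lipschitz = λ x y δ 0≤δ near → begin
          ∣ h y + k y - (h x + k x) ∣        ≈⟨ ∣∣-cong (x+y-[z+w]≈[x-z]+[y-w] _ _ _ _) ⟩
          ∣ (h y - h x) + (k y - k x) ∣      ≤⟨ ∣x+y∣≤∣x∣+∣y∣ _ _ ⟩
          ∣ h y - h x ∣ + ∣ k y - k x ∣      ≤⟨ +-mono-≤ (lipschitz H x y δ 0≤δ near) (lipschitz K x y δ 0≤δ near) ⟩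
          slope H * δ + slope K * δ          ≈⟨ distribʳ δ (slope H) (slope K) ⟨
          (slope H + slope K) * δ            ∎
      }

    -- The slope is that of the discrete product rule: change `k` with `h` held at `y`, then change
    -- `h` with `k` held at `x`.
    *-lipschitz : ∀ {n} {h k : Cube n → ℝ} →
      BoundedLipschitz h → BoundedLipschitz k → BoundedLipschitz (λ x → h x * k x)
    *-lipschitz {h = h} {k} H K = record
      { bound     = bound H * bound K
      ; slope     = bound H * slope K + slope H * bound K
      ; 0≤bound   = *-nonNeg (0≤bound H) (0≤bound K)
      ; 0≤slope   = +-nonNeg (*-nonNeg (0≤bound H) (0≤slope K)) (*-nonNeg (0≤slope H) (0≤bound K))
      ; bounded   = λ x → ∣∣*∣∣ (0≤bound H) (bounded H x) (bounded K x)
      ; lipschitz = λ x y δ 0≤δ near → begin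
          ∣ h y * k y - h x * k x ∣
            ≈⟨ ∣∣-cong (xy-zw≈x[y-w]+[x-z]w (h y) (k y) (h x) (k x)) ⟩
          ∣ h y * (k y - k x) + (h y - h x) * k x ∣
            ≤⟨ ∣x+y∣≤∣x∣+∣y∣ _ _ ⟩
          ∣ h y * (k y - k x) ∣ + ∣ (h y - h x) * k x ∣
            ≤⟨ +-mono-≤ (∣∣*∣∣ (0≤bound H) (bounded H y) (lipschitz K x y δ 0≤δ near))
                        (∣∣*∣∣ (*-nonNeg (0≤slope H) 0≤δ) (lipschitz H x y δ 0≤δ near) (bounded K x)) ⟩
          bound H * (slope K * δ) + slope H * δ * bound K
            ≈⟨ +-cong (sym (*-assoc _ _ δ)) (⟨*⟩.xy∙z≈xz∙y _ δ _) ⟩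
          bound H * slope K * δ + slope H * bound K * δ
            ≈⟨ distribʳ δ _ _ ⟨
          (bound H * slope K + slope H * bound K) * δ  ∎
      }
      where
      ∣∣*∣∣ : ∀ {a b m m′} → 0# ≤ m → ∣ a ∣ ≤ m → ∣ b ∣ ≤ m′ → ∣ a * b ∣ ≤ m * m′
      ∣∣*∣∣ {a} {b} 0≤m a≤m b≤m′ =
        ≤-trans (∣xy∣≤∣x∣∣y∣ a b) (*-mono-≤-nonNeg 0≤m (abs-nonNeg b) a≤m b≤m′)

  product-lipschitz : ∀ {m n} {h : Fin m → Cube n → ℝ} →
    (∀ i → BoundedLipschitz (h i)) → BoundedLipschitz (λ x → product (λ i → h i x))
  product-lipschitz {zero}  H = constant-lipschitz 1#
  product-lipschitz {suc m} H = *-lipschitz (H zero) (product-lipschitz (H ∘ suc))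

  sum⊆-lipschitz : ∀ {m n} {h : Subset m → Cube n → ℝ} →
    (∀ S → BoundedLipschitz (h S)) → BoundedLipschitz (λ x → sum⊆ (λ S → h S x))
  sum⊆-lipschitz {zero}  H = H []
  sum⊆-lipschitz {suc m} H =
    +-lipschitz (sum⊆-lipschitz (H ∘ (inside ∷_))) (sum⊆-lipschitz (H ∘ (outside ∷_)))

  Pr-lipschitz : ∀ {n} (S : Subset n) → BoundedLipschitz (λ x → Pr x S)
  Pr-lipschitz S = product-lipschitz λ i → bernoulli (lookup S i) i
    where
    -- The bit is abstracted from `lookup S i` so that the conditional reduces under a case split.
    bernoulli : ∀ b i → BoundedLipschitz (λ x → if b then coord x i else (1# - coord x i))
    bernoulli true  i = coord-lipschitz i
    bernoulli false i = +-lipschitz (constant-lipschitz 1#) (neg-lipschitz (coord-lipschitz i))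

  𝔼-lipschitz : ∀ {n} (g : SetFunction n) → BoundedLipschitz (λ x → 𝔼 x g)
  𝔼-lipschitz g = sum⊆-lipschitz λ S → *-lipschitz (Pr-lipschitz S) (constant-lipschitz (g S))

  lipschitz⇒continuous : ∀ {n} {h : Cube n → ℝ} → BoundedLipschitz h → ∀ x → ContinuousAt h x
  lipschitz⇒continuous {h = h} H x ε 0<ε =
    δ , 0<δ , λ y near → ≤-<-trans (lipschitz x y δ (<⇒≤ 0<δ) (<⇒≤ ∘ near)) slope*δ<ε
    where
    open BoundedLipschitz H
    0<slope+1 : 0# < slope + 1#
    0<slope+1 = +-nonNeg-pos 0≤slope 0<1
    w : ℝ
    w = reciprocal (pos⇒#0 0<slope+1)
    -- The radius is `ε` divided by `slope + 1#`. The added one keeps the divisor positive when the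
    -- slope is zero and makes `slope * δ` strictly smaller than `ε`.
    δ : ℝ
    δ = w * ε
    0<δ : 0# < δ
    0<δ = *-pos (reciprocal-pos 0<slope+1 _) 0<ε
    δ+slope*δ≈ε : δ + slope * δ ≈ ε
    δ+slope*δ≈ε = begin
      δ + slope * δ        ≈⟨ +-comm δ _ ⟩
      slope * δ + δ        ≈⟨ +-congˡ (*-identityˡ δ) ⟨
      slope * δ + 1# * δ   ≈⟨ distribʳ δ slope 1# ⟨
      (slope + 1#) * δ     ≈⟨ ⟨*⟩.x∙yz≈yx∙z (slope + 1#) w ε ⟩
      w * (slope + 1#) * ε ≈⟨ *-congʳ (reciprocal-inverseˡ _) ⟩
      1# * ε               ≈⟨ *-identityˡ ε ⟩
      ε                    ∎
      where open ≈-Reasoning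
    slope*δ<ε : slope * δ < ε
    slope*δ<ε = SP.<-respʳ-≈ δ+slope*δ≈ε $
      SP.<-respˡ-≈ (+-identityˡ (slope * δ)) (+-monoˡ-< (slope * δ) 0<δ)

  continuous-resp-≈ : ∀ {n} {h k : Cube n → ℝ} → (∀ x → k x ≈ h x) →
    ∀ x → ContinuousAt h x → ContinuousAt k x
  continuous-resp-≈ k≈h x h-cont ε 0<ε with h-cont ε 0<ε
  ... | δ , 0<δ , close = δ , 0<δ , λ y near →
    SP.<-respˡ-≈ (∣∣-cong (+-cong (sym (k≈h y)) (-‿cong (sym (k≈h x))))) (close y near)

  affine⇒HasPartialAt : ∀ {n} {h : Cube n → ℝ} {i} x {d} →
    (∀ y → (∀ k → k ≢ i → coord y k ≈ coord x k) →
      h y - h x ≈ d * (coord y i - coord x i)) →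
    HasPartialAt h i x d
  -- The remainder is exactly zero, so any positive radius serves; `1#` is an arbitrary choice.
  affine⇒HasPartialAt {h = h} {i} x {d} affine ε 0<ε = 1# , 0<1 , λ y y≈x _ → begin
    ∣ h y - h x - d * (coord y i - coord x i) ∣
      ≈⟨ ∣∣-cong (+-congʳ (affine y y≈x)) ⟩
    ∣ d * (coord y i - coord x i) - d * (coord y i - coord x i) ∣
      ≈⟨ ∣x-x∣≈0 _ ⟩
    0#
      ≤⟨ *-nonNeg (<⇒≤ 0<ε) (abs-nonNeg _) ⟩
    ε * ∣ coord y i - coord x i ∣  ∎
    where open ≤-Reasoning

  𝔼-partial : ∀ {n} (g : SetFunction n) i x → HasPartialAt (λ y → 𝔼 y g) i x (𝔼 x (B g i))
  𝔼-partial g i x = affine⇒HasPartialAt x (𝔼-difference g i x)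

  -- B (B f i) j is A f j i by definition, whence the order of the indices in ∇².
  multilinear-C² : ∀ {n} (f : SetFunction n) → C² (multilinear f)
  multilinear-C² f = record
    { ∇          = λ i x → 𝔼 x (B f i)
    ; ∇²         = λ i j x → 𝔼 x (A f j i)
    ; ∇-partial  = λ i x → affine⇒HasPartialAt x λ y y≈x →
        trans (+-cong (multilinear≈𝔼 f y) (-‿cong (multilinear≈𝔼 f x)))
              (𝔼-difference f i x y y≈x)
    ; ∇²-partial = λ i j x → 𝔼-partial (B f i) j x
    ; F-cont     = λ x →
        continuous-resp-≈ (multilinear≈𝔼 f) x (lipschitz⇒continuous (𝔼-lipschitz f) x)
    ; ∇-cont     = λ i → lipschitz⇒continuous (𝔼-lipschitz (B f i))
    ; ∇²-cont    = λ i j → lipschitz⇒continuous (𝔼-lipschitz (A f j i))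
    }

-- From entrywise bounds to a bound on the quadratic form.

module QuadraticForm {c ℓ₁ ℓ₂ ℓ₃} (𝓡 : Reals c ℓ₁ ℓ₂ ℓ₃) where

  open Reals 𝓡
  open Smoothness 𝓡
  open OrderedField 𝓡
  open SumProperties R.semiring using (∑-distrib-+; *-distribˡ-sum; *-distribʳ-sum; sum-cong-≋)

  sum-mono-≤ : ∀ {n} {v w : Fin n → ℝ} → (∀ i → v i ≤ w i) → sum v ≤ sum w
  sum-mono-≤ {zero}  v≤w = ≤-reflexive refl
  sum-mono-≤ {suc n} v≤w = +-mono-≤ (v≤w zero) (sum-mono-≤ (v≤w ∘ suc))

  sum-outer : ∀ {m n} (v : Fin m → ℝ) (w : Fin n → ℝ) →
    sum (λ i → sum (λ j → v i * w j)) ≈ sum v * sum w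
  sum-outer v w = trans
    (sum-cong-≋ (λ i → sym (*-distribˡ-sum (v i) w)))
    (sym (*-distribʳ-sum (sum w) v))

  coord-‖‖₁ : ∀ {n} (x : Cube n) → ‖ coord x ‖₁ ≈ sum (coord x)
  coord-‖‖₁ x = sum-cong-≋ (λ i → nonNeg⇒∣x∣≈x (0≤ x i))

  -- With `v i` equal to `û i * g i`, the weighted entry bound splits into two rank-one pieces. Each
  -- sums to `a * (sum û * sum v)`, and `½` absorbs the doubling. Finally `sum û` is the norm of
  -- `u`, whose coordinates are non-negative.
  half-form-≤ : ∀ {n} {h : Fin n → Fin n → ℝ} {g : Fin n → ℝ} {a} →
    (∀ i j → h i j ≤ a * (g j + g i)) → (u : Cube n) →
    ½ * sum (λ i → sum (λ j → coord u i * h i j * coord u j))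
      ≤ a * ‖ coord u ‖₁ * sum (λ i → coord u i * g i)
  half-form-≤ {h = h} {g} {a} h≤ u = begin
    ½ * sum (λ i → sum (λ j → û i * h i j * û j))
      ≤⟨ *-monoˡ-≤-nonNeg 0≤½ (sum-mono-≤ λ i → sum-mono-≤ λ j → entry i j) ⟩
    ½ * sum (λ i → sum (λ j → a * (û i * v j) + a * (v i * û j)))
      ≈⟨ *-congˡ (sum-cong-≋ λ i → ∑-distrib-+ (λ j → a * (û i * v j)) (λ j → a * (v i * û j))) ⟩
    ½ * sum (λ i → sum (λ j → a * (û i * v j)) + sum (λ j → a * (v i * û j)))
      ≈⟨ *-congˡ (∑-distrib-+ (λ i → sum (λ j → a * (û i * v j))) (λ i → sum (λ j → a * (v i * û j)))) ⟩
    ½ * (sum (λ i → sum (λ j → a * (û i * v j))) + sum (λ i → sum (λ j → a * (v i * û j))))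
      ≈⟨ *-congˡ (+-cong (scaled-outer û v) (trans (scaled-outer v û) (*-congˡ (*-comm _ _)))) ⟩
    ½ * (a * (sum û * sum v) + a * (sum û * sum v))
      ≈⟨ ½*[x+x]≈x _ ⟩
    a * (sum û * sum v)
      ≈⟨ *-assoc a (sum û) (sum v) ⟨
    a * sum û * sum v
      ≈⟨ *-congʳ (*-congˡ (coord-‖‖₁ u)) ⟨
    a * ‖ û ‖₁ * sum v  ∎
    where
    open ≤-Reasoning
    û = coord u
    v : Fin _ → ℝ
    v i = û i * g i
    scaled-outer : ∀ p q → sum (λ i → sum (λ j → a * (p i * q j))) ≈ a * (sum p * sum q)
    scaled-outer p q = trans
      (sum-cong-≋ λ i → sym (*-distribˡ-sum a (λ j → p i * q j)))
      (trans (sym (*-distribˡ-sum a (λ i → sum (λ j → p i * q j)))) (*-congˡ (sum-outer p q)))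
    entry : ∀ i j → û i * h i j * û j ≤ a * (û i * v j) + a * (v i * û j)
    entry i j = begin
      û i * h i j * û j                  ≈⟨ ⟨*⟩.xy∙z≈xz∙y (û i) (h i j) (û j) ⟩
      û i * û j * h i j                  ≤⟨ *-monoˡ-≤-nonNeg (*-nonNeg (0≤ u i) (0≤ u j)) (h≤ i j) ⟩
      û i * û j * (a * (g j + g i))      ≈⟨ ⟨*⟩.x∙yz≈y∙xz (û i * û j) a (g j + g i) ⟩
      a * (û i * û j * (g j + g i))      ≈⟨ *-congˡ (distribˡ (û i * û j) (g j) (g i)) ⟩
      a * (û i * û j * g j + û i * û j * g i)
        ≈⟨ *-congˡ (+-cong (*-assoc _ _ _) (⟨*⟩.xy∙z≈xz∙y (û i) (û j) (g i))) ⟩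
      a * (û i * v j + v i * û j)        ≈⟨ distribˡ a _ _ ⟩
      a * (û i * v j) + a * (v i * û j)  ∎

-- One-sided smoothness of the multilinear extension.

lemma3 : ∀ {c ℓ₁ ℓ₂ ℓ₃} (𝓡 : Reals c ℓ₁ ℓ₂ ℓ₃) →
    let open Reals 𝓡
        open Smoothness 𝓡
    in
    ∀ (n : ℕ) (f : SetFunction n) → NonNegative f → Monotone f →
    ∀ (x : Cube n) (x≠0 : Nonzero (coord x)) (γ : ℝ) → 0# ≤ γ →
    (∀ (i j : Fin n) →
      𝔼 x size * 𝔼 x (A f i j) ≤ γ * (𝔼 x (B f i) + 𝔼 x (B f j))) →
    OneSidedSmoothAt γ (multilinear f) x x≠0
lemma3 𝓡 n f _ _ x x≠0 γ _ hyp = multilinear-C² f , λ u → begin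
  ½ * sum (λ i → sum (λ j → coord u i * 𝔼 x (A f j i) * coord u j))
    ≤⟨ half-form-≤ hessian-≤ u ⟩
  γ * w * ‖ coord u ‖₁ * sum (λ i → coord u i * 𝔼 x (B f i))
    -- Moves `w` behind the norm of `u`, where the quotient `_/_[_]` has it.
    ≈⟨ *-congʳ (trans (*-assoc γ w _) (*-congˡ (*-comm w _))) ⟩
  γ * (‖ coord u ‖₁ / ‖ coord x ‖₁ [ ‖‖₁#0 {v = coord x} x≠0 ]) * sum (λ i → coord u i * 𝔼 x (B f i))  ∎
  where
  open Reals 𝓡
  open Smoothness 𝓡
  open OrderedField 𝓡
  open Expectation 𝓡
  open Regularity 𝓡
  open QuadraticForm 𝓡
  open ≤-Reasoning
  -- The reciprocal of the norm of `x`, and by `𝔼-size` also that of `𝔼 x size`.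
  w : ℝ
  w = reciprocal (‖‖₁#0 {v = coord x} x≠0)
  0≤w : 0# ≤ w
  0≤w = <⇒≤ $ reciprocal-pos
    (sum-pos _ (λ i → abs-nonNeg (coord x i)) (proj₁ x≠0) (abs-pos (proj₂ x≠0)))
    (‖‖₁#0 {v = coord x} x≠0)
  w*size≈1 : w * 𝔼 x size ≈ 1#
  w*size≈1 = trans
    (*-congˡ (trans (𝔼-size x) (sym (coord-‖‖₁ x))))
    (reciprocal-inverseˡ (‖‖₁#0 {v = coord x} x≠0))
  hessian-≤ : ∀ i j → 𝔼 x (A f j i) ≤ γ * w * (𝔼 x (B f j) + 𝔼 x (B f i))
  hessian-≤ i j = begin
    𝔼 x (A f j i)                            ≈⟨ *-identityˡ _ ⟨
    1# * 𝔼 x (A f j i)                       ≈⟨ *-congʳ w*size≈1 ⟨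
    w * 𝔼 x size * 𝔼 x (A f j i)             ≈⟨ *-assoc w _ _ ⟩
    -- The hypothesis is taken at `j i` because the entry of `∇²` at `i j` is the expectation of
    -- `A f j i`.
    w * (𝔼 x size * 𝔼 x (A f j i))           ≤⟨ *-monoˡ-≤-nonNeg 0≤w (hyp j i) ⟩
    w * (γ * (𝔼 x (B f j) + 𝔼 x (B f i)))    ≈⟨ ⟨*⟩.x∙yz≈yx∙z w γ _ ⟩
    γ * w * (𝔼 x (B f j) + 𝔼 x (B f i))      ∎
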